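{- Let $n\ge 5$. Then \[(5n-6+\operatorname{sgn}'(n))/2\le R(\widehat{K}_n,\widehat{K}_n)\le 4n-6,\] where $\operatorname{sgn}'(n)=1$ if $n\equiv 3\pmod 4$, $\operatorname{sgn}'(n)=0$ if $n$ is even, and $\operatorname{sgn}'(n)=-1$ if $n\equiv 1\pmod 4$.
   Context: For graphs $G_1,G_2$, the Ramsey number $R(G_1,G_2)$ is the smallest positive integer $N$ such that every red-blue edge-coloring of $K_N$ contains a red copy of $G_1$ or a blue copy of $G_2$. For a graph $G$, $K_1+G$ denotes the graph obtained by adding a new vertex adjacent to every vertex of $G$. The kipas $\widehat{K}_n$ is the graph $K_1+P_{n-1}$ on $n$ vertices, where $P_{n-1}$ is the path on $n-1$ vertices. -}

module Defs where

open import Data.Nat using (ℕ; zero; suc; _+_; _*_; _≤_; _<_; _%_)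
open import Data.Fin using (Fin; toℕ)
import Data.Fin as F
open import Data.Bool using (Bool; true; false)
open import Data.Product using (Σ; _×_; ∃)
open import Data.Sum using (_⊎_)
open import Data.Empty using (⊥)
open import Data.Unit using (⊤)
open import Data.Integer using (ℤ; +_; -_; 0ℤ; 1ℤ)
open import Relation.Nullary using (¬_)
open import Relation.Binary.PropositionalEquality using (_≡_)
open import Function.Definitions using (Injective)

record Graph (n : ℕ) : Set₁ where
  field
    Adj : Fin n → Fin n → Set

-- Red-blue edge colouring of the complete graph K_N:
-- a symmetric colour assignment (values on the diagonal are irrelevant).
Colour : Set
Colour = Bool

red blue : Colour
red  = true
blue = false

record Colouring (N : ℕ) : Set where
  field
    col : Fin N → Fin N → Colour
    sym : ∀ i j → col i j ≡ col j i

MonoCopy : ∀ {m} → (N : ℕ) → Colouring N → Colour → Graph m → Set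
MonoCopy {m} N c k G =
  Σ (Fin m → Fin N) λ f →
    Injective _≡_ _≡_ f ×
    (∀ i j → Graph.Adj G i j → Colouring.col c (f i) (f j) ≡ k)

Arrows : ∀ {m₁ m₂} → ℕ → Graph m₁ → Graph m₂ → Set
Arrows N G₁ G₂ = (c : Colouring N) → MonoCopy N c red G₁ ⊎ MonoCopy N c blue G₂

IsRamseyNumber : ∀ {m₁ m₂} → ℕ → Graph m₁ → Graph m₂ → Set
IsRamseyNumber r G₁ G₂ =
  1 ≤ r × Arrows r G₁ G₂ × (∀ N → 1 ≤ N → N < r → ¬ Arrows N G₁ G₂)

PathAdj : ℕ → ℕ → Set
PathAdj i j = suc i ≡ j ⊎ suc j ≡ i

-- Kipas K̂_n = K_1 + P_{n-1} on Fin n: vertex 0 is the hub, vertices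
-- 1..n-1 form the path (in their natural order).
KipasAdj : ∀ {n} → Fin n → Fin n → Set
KipasAdj F.zero    F.zero    = ⊥
KipasAdj F.zero    (F.suc j) = ⊤
KipasAdj (F.suc i) F.zero    = ⊤
KipasAdj (F.suc i) (F.suc j) = PathAdj (toℕ i) (toℕ j)

Kipas : (n : ℕ) → Graph n
Kipas n = record { Adj = KipasAdj }

sgn′ : ℕ → ℤ
sgn′ n with n % 4
... | 1 = - 1ℤ
... | 3 = 1ℤ
... | _ = 0ℤ

{-# OPTIONS --safe #-}
module Submission where

-- Upper bound. Put p = n - 1, and let red be the majority colour at a vertex of K_{4p-2}; its red neighbourhood L has
-- at least 2p - 1 vertices. If L contains a red path on p vertices we are done, so suppose it does not; then a blue
-- kipas is found inside L. By the Gerencsér–Gyárfás argument no vertex may have p + ⌈p/2⌉ - 1 blue neighbours in L.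
-- Take a longest red path Q in L with first vertex u. The predecessors on Q of the red neighbours of u, together with
-- the last vertex, form a set E of more than ⌊p/2⌋ vertices that is completely blue to O = L \ Q. If some vertex of O
-- has ⌊p/2⌋ blue neighbours in O, these alternate with E and form a blue kipas with it. Otherwise the same step inside
-- O gives a set E′ that is completely blue to the nonempty rest of O; a vertex of that rest is the hub, and E and E′
-- alternate.
--
-- The path Ramsey bound extends a longest red path: every outside vertex is blue to its first vertex and to one of any
-- two consecutive vertices. As long as three blue segments with outside ends are left, two of three heads have a common
-- blue neighbour in a given consecutive pair; the last two segments are joined through the first vertex of the path.
--
-- Lower bound. A red clique on n - 1 vertices is joined in blue to a set Z on which blue is (nearly) regular of degree
-- ⌊(n-3)/2⌋ with components of at most n - 2 vertices. Red neighbourhoods have at most n - 2 vertices. A blue path in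
-- the neighbourhood of a clique vertex stays in one component of Z; for a hub in Z the blue path meets Z in at
-- least every second vertex.

open import Defs
open import Data.Bool using (Bool; true; false; not; if_then_else_; _∧_; _∨_)
open import Data.Bool.Properties using (¬-not; not-injective; ∨-comm) renaming (_≟_ to _≟ᵇ_)
open import Data.Empty using (⊥; ⊥-elim)
open import Data.Fin using (Fin; zero; suc; toℕ; inject≤; _↑ˡ_; finToFun; funToFin)
import Data.Fin as Fin using (_≟_)
open import Data.Fin.Properties using (any?; all?; finToFun-funToFin; 2↔Bool; inject≤-injective; injective⇒≤) renaming (suc-injective to Fin-suc-injective)
open import Data.List using (List; []; _∷_; _++_; [_]; length; map; concatMap; foldr; take; drop; lookup; allFin; replicate)
open import Data.List.Properties using (++-assoc; ++-identityʳ; concatMap-++; length-++; take++drop≡id; length-take; length-tabulate; length-replicate)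
open import Data.List.Membership.Propositional using (_∈_)
open import Data.List.Membership.Propositional.Properties using (∈-∃++; ∈-++⁺ˡ; ∈-++⁺ʳ; ∈-lookup)
open import Data.List.Relation.Binary.Permutation.Propositional using (_↭_; ↭-refl; ↭-sym; ↭-trans; ↭-reflexive; ↭⇒↭ₛ; prep; swap; module PermutationReasoning)
open import Data.List.Relation.Binary.Permutation.Propositional.Properties using (↭-length; ++⁺ˡ; ++⁺ʳ; shift; ∈-resp-↭; shifts; ++-comm; All-resp-↭; ∷↭∷ʳ)
open import Data.List.Relation.Unary.Any using (here; there)
open import Data.List.Relation.Unary.Linked using (Linked; []; [-]; _∷_) renaming (tail to linked-tail)
open import Data.Nat using (ℕ; zero; suc; _+_; _*_; _∸_; _≤_; _<_; z≤n; s≤s; ⌊_/2⌋; ⌈_/2⌉; _≤ᵇ_; _^_)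
open import Data.Nat.ListAction using (sum)
open import Data.Nat.DivMod using (_/_; _%_; m≡m%n+[m/n]*n; m%n<n)
open import Data.Nat.Properties
open import Data.Nat.Tactic.RingSolver using (solve-∀)
open import Data.Product using (Σ; ∃; _×_; _,_; proj₁; proj₂; ∃-syntax)
open import Data.Sum using (_⊎_; inj₁; inj₂)
open import Relation.Nullary using (¬_; Dec; does; yes; no; contradiction)
open import Relation.Nullary.Decidable using (map′; decidable-stable; _⊎-dec_; _×-dec_; _→-dec_; from-yes; dec-true)
open import Relation.Binary.PropositionalEquality using (_≡_; refl; sym; trans; cong; cong₂; subst; setoid; _≗_; module ≡-Reasoning)
open import Data.List.Relation.Unary.All using (All; []; _∷_)
import Data.List.Relation.Unary.All as All using (lookup; tabulate)
import Data.List.Relation.Unary.All.Properties as All using (++⁺; ++⁻ˡ)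
import Data.Sum as Sum using (map)
open import Data.List.Relation.Unary.Unique.Propositional using (Unique; []; _∷_)
open import Data.List.Relation.Unary.Unique.Propositional.Properties using (allFin⁺)
open import Data.List.Relation.Binary.Permutation.Setoid.Properties using (Unique-resp-↭)
open import Data.Unit using (tt)
open import Function using (id; _∘_; Inverse)
open import Function.Definitions using (Injective)

-- Linear arithmetic by way of the ring solver.
by-sum : ∀ {a b l r} → l ≤ r → b + l ≡ a + r → a ≤ b
by-sum {a} {b} {l} {r} l≤r eq = +-cancelʳ-≤ r a b (begin
  a + r  ≡⟨ eq ⟨
  b + l  ≤⟨ +-monoʳ-≤ b l≤r ⟩
  b + r  ∎)
  where open ≤-Reasoning

-- Inequalities for the upper bound.

private
  half-step : ∀ {d z} → 2 * suc d ≤ 2 + z → 2 * d ≤ z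
  half-step {d} {z} le = by-sum le (lemma d z)
    where
    lemma : ∀ d z → z + 2 * suc d ≡ 2 * d + (2 + z)
    lemma = solve-∀

  half-suc : ∀ z d → z + 2 * suc d ≡ 2 + (z + 2 * d)
  half-suc = solve-∀

  segment-size : ∀ {n d q z t r} → d ≡ n → t ≡ n → z + 2 * n ≡ q → r + (z + t) ≡ 3 + (d + q) → r ≡ 3 + 2 * n
  segment-size {n} {z = z} {r = r} refl refl refl eq = +-cancelʳ-≡ (z + n) r (3 + 2 * n) (trans eq (lemma n z))
    where
    lemma : ∀ n z → 3 + (n + (z + 2 * n)) ≡ 3 + 2 * n + (z + n)
    lemma = solve-∀

  odd-suc : ∀ n → 3 + 2 * n ≡ 1 + 2 * suc n
  odd-suc = solve-∀

  double-suc : ∀ n → 2 + 2 * n ≡ 2 * suc n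
  double-suc = solve-∀

  triple-suc : ∀ n → 2 + (2 + 3 * n) ≡ 1 + 3 * suc n
  triple-suc = solve-∀

  outside-even : ∀ n {b l} → 1 + 3 * suc n ≤ l → (2 + 2 * n) + b ≡ l → 2 + n ≤ b
  outside-even n {b} le refl = by-sum le (lemma n b)
    where
    lemma : ∀ n b → b + (1 + 3 * suc n) ≡ 2 + n + ((2 + 2 * n) + b)
    lemma = solve-∀

  outside-odd : ∀ n {b l} → 2 + 3 * suc n ≤ l → (1 + 2 * suc n) + b ≡ l → 2 + n ≤ b
  outside-odd n {b} le refl = by-sum le (lemma n b)
    where
    lemma : ∀ n b → b + (2 + 3 * suc n) ≡ 2 + n + ((1 + 2 * suc n) + b)
    lemma = solve-∀

  parity : ∀ p → 1 ≤ p → ∃[ n ] (p ≡ 1 + 2 * n ⊎ p ≡ 2 + 2 * n)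
  parity (suc zero)          _ = 0 , inj₁ refl
  parity (suc (suc zero))    _ = 0 , inj₂ refl
  parity (suc (suc (suc p))) _ with parity (suc p) (s≤s z≤n)
  ... | n , inj₁ eq = suc n , inj₁ (trans (cong (2 +_) eq) (odd-suc n))
  ... | n , inj₂ eq = suc n , inj₂ (trans (cong (2 +_) eq) (cong suc (odd-suc n)))

  ⌊2n/2⌋≡n : ∀ n → ⌊ 2 * n /2⌋ ≡ n
  ⌊2n/2⌋≡n zero    = refl
  ⌊2n/2⌋≡n (suc n) = trans (cong ⌊_/2⌋ (sym (double-suc n))) (cong suc (⌊2n/2⌋≡n n))

  ⌈2n/2⌉≡n : ∀ n → ⌈ 2 * n /2⌉ ≡ n
  ⌈2n/2⌉≡n zero    = refl
  ⌈2n/2⌉≡n (suc n) = trans (cong ⌈_/2⌉ (sym (double-suc n))) (cong suc (⌈2n/2⌉≡n n))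

  odd-bound : ∀ n → 2 + 3 * n ≡ 1 + 2 * n + ⌈ 1 + 2 * n /2⌉
  odd-bound n = trans (lemma n) (cong (λ h → 1 + 2 * n + suc h) (sym (⌊2n/2⌋≡n n)))
    where
    lemma : ∀ n → 2 + 3 * n ≡ 1 + 2 * n + suc n
    lemma = solve-∀

  even-bound : ∀ n → 3 + 3 * n ≡ 2 + 2 * n + ⌈ 2 + 2 * n /2⌉
  even-bound n = trans (lemma n) (cong (λ h → 2 + 2 * n + suc h) (sym (⌈2n/2⌉≡n n)))
    where
    lemma : ∀ n → 3 + 3 * n ≡ 2 + 2 * n + suc n
    lemma = solve-∀

  -- For a longest path, `r` and `b` count the other path vertices that its first vertex does and
  -- does not see in the colour of the path, `o` the vertices outside, and `e` the possible ends.
  ends-bound : ∀ {b r o q e l d} → b + o < d → q ≡ b + r → e ≡ suc r → suc (q + o) ≡ l → l < e + d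
  ends-bound {b} {r} {o} {d = d} lt refl refl refl = by-sum lt (lemma b r o d)
    where
    lemma : ∀ b r o d → suc r + d + suc (b + o) ≡ suc (suc (b + r + o)) + d
    lemma = solve-∀

  ends-many : ∀ {n l e q s} → s + q ≡ suc n → 2 * suc n ≤ suc l → l < e + (n + q) → s < e
  ends-many {n} {l} {e} {q} {s} eq le lt = by-sum (+-mono-≤ (+-mono-≤ le lt) (≤-reflexive eq)) (lemma n l e q s)
    where
    lemma : ∀ n l e q s → e + (2 * suc n + suc l + (s + q)) ≡ suc s + (suc l + (e + (n + q)) + suc n)
    lemma = solve-∀

  outside-many : ∀ {n l e f o} → 2 * suc n ≤ suc l → e + f ≤ n → e + (f + o) ≡ l → suc n ≤ o
  outside-many {n} {_} {e} {f} {o} le le′ refl = by-sum (+-mono-≤ le le′) (lemma n e f o)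
    where
    lemma : ∀ n e f o → o + (2 * suc n + (e + f)) ≡ suc n + (suc (e + (f + o)) + n)
    lemma = solve-∀

  ends-many′ : ∀ {n o e q s} → s + q ≡ suc n → suc n ≤ o → o < e + s → q < e
  ends-many′ {n} {o} {e} {q} {s} eq le lt = by-sum (+-mono-≤ (+-mono-≤ le lt) (≤-reflexive eq)) (lemma n o e q s)
    where
    lemma : ∀ n o e q s → e + (suc n + suc o + (s + q)) ≡ suc q + (o + (e + s) + suc n)
    lemma = solve-∀

  outside-nonempty : ∀ {n l e f o} → suc n ≤ l → e + f ≤ n → e + (f + o) ≡ l → 1 ≤ o
  outside-nonempty {n} {_} {e} {f} {o} le le′ refl = by-sum (+-mono-≤ le le′) (lemma n e f o)
    where
    lemma : ∀ n e f o → o + (suc n + (e + f)) ≡ 1 + ((e + (f + o)) + n)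
    lemma = solve-∀

  majority : ∀ {m l r b} → 4 * m ≤ 3 + l → l ≡ r + b → 2 * m ≤ suc r ⊎ 2 * m ≤ suc b
  majority {m} {l} {r} {b} le refl with ≤-<-connex (2 * m) (suc r)
  ... | inj₁ le′ = inj₁ le′
  ... | inj₂ lt  = inj₂ (by-sum (+-mono-≤ le lt) (lemma m r b))
    where
    lemma : ∀ m r b → suc b + (4 * m + suc (suc r)) ≡ 2 * m + (3 + (r + b) + 2 * m)
    lemma = solve-∀

-- Permutations of concatenated lists.

-- Two concatenations agree up to permutation when their sorted lists of atoms agree, which refl decides.
module Rearrange {V : Set} where

  infixr 5 _⊕_
  infix  6 #_

  data Expr : Set where
    #_  : ℕ → Expr
    _⊕_ : Expr → Expr → Expr

  private
    nth : List (List V) → ℕ → List V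
    nth []       _       = []
    nth (l ∷ ls) zero    = l
    nth (l ∷ ls) (suc i) = nth ls i

    value : List (List V) → Expr → List V
    value ρ (# i)   = nth ρ i
    value ρ (e ⊕ f) = value ρ e ++ value ρ f

    atoms : Expr → List ℕ
    atoms (# i)   = [ i ]
    atoms (e ⊕ f) = atoms e ++ atoms f

    insert : ℕ → List ℕ → List ℕ
    insert i []       = [ i ]
    insert i (j ∷ js) = if i ≤ᵇ j then i ∷ j ∷ js else j ∷ insert i js

    sort : List ℕ → List ℕ
    sort = foldr insert []

    insert-↭ : ∀ i js → insert i js ↭ i ∷ js
    insert-↭ i []       = ↭-refl
    insert-↭ i (j ∷ js) with i ≤ᵇ j
    ... | true  = ↭-refl
    ... | false = ↭-trans (prep j (insert-↭ i js)) (swap j i ↭-refl)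

    sort-↭ : ∀ is → sort is ↭ is
    sort-↭ []       = ↭-refl
    sort-↭ (i ∷ is) = ↭-trans (insert-↭ i (sort is)) (prep i (sort-↭ is))

    value-atoms : ∀ ρ e → value ρ e ≡ concatMap (nth ρ) (atoms e)
    value-atoms ρ (# i)   = sym (++-identityʳ (nth ρ i))
    value-atoms ρ (e ⊕ f) = trans (cong₂ _++_ (value-atoms ρ e) (value-atoms ρ f)) (sym (concatMap-++ (nth ρ) (atoms e) (atoms f)))

    concatMap-↭ : ∀ (f : ℕ → List V) {is js} → is ↭ js → concatMap f is ↭ concatMap f js
    concatMap-↭ f _↭_.refl        = ↭-refl
    concatMap-↭ f (prep i σ)      = ++⁺ˡ (f i) (concatMap-↭ f σ)
    concatMap-↭ f (swap i j σ) = ↭-trans (shifts (f i) (f j)) (++⁺ˡ (f j) (++⁺ˡ (f i) (concatMap-↭ f σ)))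
    concatMap-↭ f (_↭_.trans σ τ) = ↭-trans (concatMap-↭ f σ) (concatMap-↭ f τ)

  rearrange : ∀ ρ e f → sort (atoms e) ≡ sort (atoms f) → value ρ e ↭ value ρ f
  rearrange ρ e f eq = begin
    value ρ e                    ≡⟨ value-atoms ρ e ⟩
    concatMap (nth ρ) (atoms e)  ↭⟨ concatMap-↭ (nth ρ) (sort-↭ (atoms e)) ⟨
    concatMap (nth ρ) (sort (atoms e)) ≡⟨ cong (concatMap (nth ρ)) eq ⟩
    concatMap (nth ρ) (sort (atoms f)) ↭⟨ concatMap-↭ (nth ρ) (sort-↭ (atoms f)) ⟩
    concatMap (nth ρ) (atoms f)  ≡⟨ value-atoms ρ f ⟨
    value ρ f                    ∎
    where open PermutationReasoning

-- Walks and longest paths in a two-coloured complete graph.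

module Walks {V : Set} (c : V → V → Bool) (c-sym : ∀ x y → c x y ≡ c y x) where

  open Rearrange {V}

  Edge : Bool → V → V → Set
  Edge k x y = c x y ≡ k

  edge-sym : ∀ {k x y} → Edge k x y → Edge k y x
  edge-sym {x = x} {y} e = trans (c-sym y x) e

  colour-cases : ∀ k x y → Edge k x y ⊎ Edge (not k) x y
  colour-cases k x y with c x y ≟ᵇ k
  ... | yes e = inj₁ e
  ... | no ¬e = inj₂ (¬-not ¬e)

  -- The list holds the vertices after the starting one, which makes concatenation associative on the nose.
  data Walk (k : Bool) : V → List V → V → Set where
    []  : ∀ {u} → Walk k u [] u
    _∷_ : ∀ {u w v xs} → Edge k u w → Walk k w xs v → Walk k u (w ∷ xs) v

  _++ʷ_ : ∀ {k u v w xs ys} → Walk k u xs v → Walk k v ys w → Walk k u (xs ++ ys) w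
  []      ++ʷ q = q
  (e ∷ p) ++ʷ q = e ∷ (p ++ʷ q)

  reverse-walk : ∀ {k u v xs} → Walk k u xs v → ∃[ ys ] Walk k v ys u × v ∷ ys ↭ u ∷ xs
  reverse-walk [] = [] , [] , ↭-refl
  reverse-walk {u = u} {v} (_∷_ {xs = xs} e p) with reverse-walk p
  ... | ys , q , σ = ys ++ [ u ] , q ++ʷ (edge-sym e ∷ []) ,
    ↭-trans (↭-sym (∷↭∷ʳ u (v ∷ ys))) (prep u σ)

  -- Distinctness of the vertices is inherited from `L` through `split`; it stays implicit until `L`
  -- is the list of all vertices.
  record HasPath (k : Bool) (p : ℕ) (L : List V) : Set where
    constructor path
    field
      {start end} : V
      {tail rest} : List V
      walk        : Walk k start tail end
      size        : suc (length tail) ≡ p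
      split       : start ∷ tail ++ rest ↭ L

  HasPath-mono : ∀ {k p M rest L} → M ++ rest ↭ L → HasPath k p M → HasPath k p L
  HasPath-mono {rest = rest} σ (path {start} {end} {tail} {rest′} w n τ) =
    path {rest = rest′ ++ rest} w n (↭-trans (↭-reflexive (sym (++-assoc (start ∷ tail) rest′ rest))) (↭-trans (++⁺ʳ rest τ) σ))

  -- Ranging over all walks on `xs` and one more vertex, not only over extensions of a given walk,
  -- rules out insertions and rotations as well.
  Maximal : Bool → List V → List V → Set
  Maximal k xs B = ∀ {b u v ys} → b ∈ B → Walk k u ys v → u ∷ ys ↭ b ∷ xs → ⊥

  Maximal-resp : ∀ {k xs xs′ B} → xs ↭ xs′ → Maximal k xs B → Maximal k xs′ B
  Maximal-resp σ mx b∈B w τ = mx b∈B w (↭-trans τ (prep _ (↭-sym σ)))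

  longest⇒Maximal : ∀ {k p L xs B} → ¬ HasPath k (suc p) L → length xs ≡ p → xs ++ B ↭ L → Maximal k xs B
  longest⇒Maximal {L = L} {xs} {B} ¬P n σ {b} {u} {v} {ys} b∈B w τ with ∈-∃++ b∈B
  ... | B₁ , B₂ , refl = ¬P (path {rest = B₁ ++ B₂} w (trans (↭-length τ) (cong suc n)) (begin
      (u ∷ ys) ++ B₁ ++ B₂   ↭⟨ ++⁺ʳ (B₁ ++ B₂) τ ⟩
      b ∷ xs ++ B₁ ++ B₂     ↭⟨ rearrange ([ b ] ∷ xs ∷ B₁ ∷ B₂ ∷ []) (# 0 ⊕ # 1 ⊕ # 2 ⊕ # 3) (# 1 ⊕ # 2 ⊕ # 0 ⊕ # 3) refl ⟩
      xs ++ B₁ ++ b ∷ B₂     ↭⟨ σ ⟩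
      L                      ∎))
    where open PermutationReasoning

  Maximal⇒start : ∀ {k u v qs B} → Maximal k (u ∷ qs) B → Walk k u qs v → ∀ {b} → b ∈ B → Edge (not k) b u
  Maximal⇒start {k} {u} mx p {b} b∈B with colour-cases k b u
  ... | inj₂ e = e
  ... | inj₁ e = ⊥-elim (mx b∈B (e ∷ p) ↭-refl)

  Covers : Bool → (V → Set) → V → V → Set
  Covers k P x y = ∀ {b} → P b → Edge k b x ⊎ Edge k b y

  -- A vertex joined in colour `k` to two consecutive vertices could be inserted between them. The
  -- part `ps` already traversed is kept in order to rebuild the longer walk.
  Maximal⇒covers : ∀ {k u x v ps qs B} → Maximal k (u ∷ ps ++ qs) B → Walk k u ps x → Walk k x qs v →
                   Linked (Covers (not k) (_∈ B)) (x ∷ qs)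
  Maximal⇒covers mx p [] = [-]
  Maximal⇒covers {k} {u} {x} {v} {ps} {y ∷ qs} {B} mx p (e ∷ q) =
    cover ∷ Maximal⇒covers (subst (λ l → Maximal k (u ∷ l) B) (sym (++-assoc ps [ y ] qs)) mx) (p ++ʷ (e ∷ [])) q
    where
    cover : Covers (not k) (_∈ B) x y
    cover {b} b∈B with colour-cases k b x | colour-cases k b y
    ... | inj₂ f | _      = inj₁ f
    ... | inj₁ _ | inj₂ g = inj₂ g
    ... | inj₁ f | inj₁ g = ⊥-elim (mx b∈B (p ++ʷ (edge-sym f ∷ g ∷ q)) (shift b (u ∷ ps) (y ∷ qs)))

  -- Linking segments: the Ramsey bound for paths.

  record Segment (k : Bool) (P : V → Set) : Set where
    constructor segment
    field
      {head last} : V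
      {tail}      : List V
      walk        : Walk k head tail last
      head-P      : P head
      last-P      : P last

    vertices : List V
    vertices = head ∷ tail

  open Segment using (vertices)

  module _ {k : Bool} {P : V → Set} where

    -- Walk `s` backwards to its head, cross `z` and follow `t`; the new ends are the last vertices
    -- of `s` and `t`.
    bridge : (s t : Segment k P) → ∀ {z} → Edge k (Segment.head s) z → Edge k (Segment.head t) z →
             ∃[ r ] vertices {k} {P} r ↭ z ∷ vertices s ++ vertices t
    bridge s t {z} e f with reverse-walk (Segment.walk s)
    ... | ys , w , σ = segment (w ++ʷ (e ∷ edge-sym f ∷ Segment.walk t)) (Segment.last-P s) (Segment.last-P t) ,
      ↭-trans (shift z (Segment.last s ∷ ys) (vertices t)) (prep z (++⁺ʳ (vertices t) σ))

    -- Three heads, each joined to x or to y: two of them are joined to the same vertex.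
    merge : (s t d : Segment k P) → ∀ {x y} → Covers k P x y →
            ∃[ s′ ] ∃[ t′ ] ∃[ z ] vertices {k} {P} s′ ++ vertices {k} {P} t′ ++ [ z ] ↭ vertices s ++ vertices t ++ vertices d ++ x ∷ [ y ]
    merge s t d {x} {y} cov with cov (Segment.head-P s) | cov (Segment.head-P t) | cov (Segment.head-P d)
    ... | inj₁ e | inj₁ f | _ with bridge s t e f
    ...   | r , σ = r , d , y , ↭-trans (++⁺ʳ (vertices d ++ [ y ]) σ)
              (rearrange ([ x ] ∷ [ y ] ∷ vertices s ∷ vertices t ∷ vertices d ∷ []) ((# 0 ⊕ # 2 ⊕ # 3) ⊕ # 4 ⊕ # 1) (# 2 ⊕ # 3 ⊕ # 4 ⊕ # 0 ⊕ # 1) refl)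
    merge s t d {x} {y} cov | inj₂ e | inj₂ f | _ with bridge s t e f
    ...   | r , σ = r , d , x , ↭-trans (++⁺ʳ (vertices d ++ [ x ]) σ)
              (rearrange ([ x ] ∷ [ y ] ∷ vertices s ∷ vertices t ∷ vertices d ∷ []) ((# 1 ⊕ # 2 ⊕ # 3) ⊕ # 4 ⊕ # 0) (# 2 ⊕ # 3 ⊕ # 4 ⊕ # 0 ⊕ # 1) refl)
    merge s t d {x} {y} cov | inj₁ e | inj₂ _ | inj₁ f with bridge s d e f
    ...   | r , σ = r , t , y , ↭-trans (++⁺ʳ (vertices t ++ [ y ]) σ)
              (rearrange ([ x ] ∷ [ y ] ∷ vertices s ∷ vertices t ∷ vertices d ∷ []) ((# 0 ⊕ # 2 ⊕ # 4) ⊕ # 3 ⊕ # 1) (# 2 ⊕ # 3 ⊕ # 4 ⊕ # 0 ⊕ # 1) refl)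
    merge s t d {x} {y} cov | inj₂ e | inj₁ _ | inj₂ f with bridge s d e f
    ...   | r , σ = r , t , x , ↭-trans (++⁺ʳ (vertices t ++ [ x ]) σ)
              (rearrange ([ x ] ∷ [ y ] ∷ vertices s ∷ vertices t ∷ vertices d ∷ []) ((# 1 ⊕ # 2 ⊕ # 4) ⊕ # 3 ⊕ # 0) (# 2 ⊕ # 3 ⊕ # 4 ⊕ # 0 ⊕ # 1) refl)
    merge s t d {x} {y} cov | inj₂ _ | inj₁ e | inj₁ f with bridge t d e f
    ...   | r , σ = r , s , y , ↭-trans (++⁺ʳ (vertices s ++ [ y ]) σ)
              (rearrange ([ x ] ∷ [ y ] ∷ vertices s ∷ vertices t ∷ vertices d ∷ []) ((# 0 ⊕ # 3 ⊕ # 4) ⊕ # 2 ⊕ # 1) (# 2 ⊕ # 3 ⊕ # 4 ⊕ # 0 ⊕ # 1) refl)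
    merge s t d {x} {y} cov | inj₁ _ | inj₂ e | inj₂ f with bridge t d e f
    ...   | r , σ = r , s , x , ↭-trans (++⁺ʳ (vertices s ++ [ x ]) σ)
              (rearrange ([ x ] ∷ [ y ] ∷ vertices s ∷ vertices t ∷ vertices d ∷ []) ((# 1 ⊕ # 3 ⊕ # 4) ⊕ # 2 ⊕ # 0) (# 2 ⊕ # 3 ⊕ # 4 ⊕ # 0 ⊕ # 1) refl)

    -- Each member of `ds` costs one `merge`, which consumes a consecutive pair of `zs`: one vertex
    -- links two segments, the other goes to `rest`. Finally `hub` links the last two segments.
    connect : (s t : Segment k P) (ds : List (Segment k P)) → ∀ {hub} → (∀ {b} → P b → Edge k b hub) →
              ∀ zs → Linked (Covers k P) zs → 2 * length ds ≤ length zs →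
              ∃[ r ] ∃[ zs′ ] ∃[ rest ]
                vertices {k} {P} r ++ zs′ ++ rest ↭ hub ∷ vertices s ++ vertices t ++ concatMap vertices ds ++ zs ×
                length zs′ + 2 * length ds ≡ length zs × Linked (Covers k P) zs′ × length rest ≡ length ds
    connect s t [] {hub} joined zs cov _ with bridge s t (joined (Segment.head-P s)) (joined (Segment.head-P t))
    ... | r , σ = r , zs , [] ,
      ↭-trans (++⁺ʳ (zs ++ []) σ) (rearrange ([ hub ] ∷ vertices s ∷ vertices t ∷ zs ∷ [] ∷ []) ((# 0 ⊕ # 1 ⊕ # 2) ⊕ # 3 ⊕ # 4) (# 0 ⊕ # 1 ⊕ # 2 ⊕ # 4 ⊕ # 3) refl) ,
      +-identityʳ _ , cov , refl
    connect s t (d ∷ ds) joined []           cov ()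
    connect s t (d ∷ ds) joined (x ∷ [])     cov (s≤s le) = contradiction (subst (_≤ 0) (+-suc (length ds) _) le) λ ()
    connect s t (d ∷ ds) {hub} joined (x ∷ y ∷ zs) (cxy ∷ cov) le with merge s t d cxy
    ... | s′ , t′ , z , σ with connect s′ t′ ds joined zs (linked-tail cov) (half-step le)
    ...   | r , zs′ , rest , τ , n , cov′ , m = r , zs′ , z ∷ rest , perm′ , size , cov′ , cong suc m
      where
      size : length zs′ + 2 * suc (length ds) ≡ suc (suc (length zs))
      size = trans (half-suc (length zs′) (length ds)) (cong (2 +_) n)
      D = concatMap vertices ds
      open PermutationReasoning
      perm′ : vertices r ++ zs′ ++ z ∷ rest ↭ hub ∷ vertices s ++ vertices t ++ (vertices d ++ D) ++ x ∷ y ∷ zs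
      perm′ = begin
        vertices r ++ zs′ ++ z ∷ rest
          ↭⟨ rearrange (vertices r ∷ zs′ ∷ [ z ] ∷ rest ∷ []) (# 0 ⊕ # 1 ⊕ # 2 ⊕ # 3) (# 2 ⊕ # 0 ⊕ # 1 ⊕ # 3) refl ⟩
        z ∷ vertices r ++ zs′ ++ rest
          ↭⟨ prep z τ ⟩
        z ∷ hub ∷ vertices s′ ++ vertices t′ ++ D ++ zs
          ↭⟨ rearrange ([ z ] ∷ [ hub ] ∷ vertices s′ ∷ vertices t′ ∷ D ∷ zs ∷ []) (# 0 ⊕ # 1 ⊕ # 2 ⊕ # 3 ⊕ # 4 ⊕ # 5) ((# 1 ⊕ # 2 ⊕ # 3 ⊕ # 0) ⊕ # 4 ⊕ # 5) refl ⟩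
        (hub ∷ vertices s′ ++ vertices t′ ++ [ z ]) ++ D ++ zs
          ↭⟨ ++⁺ʳ (D ++ zs) (prep hub σ) ⟩
        (hub ∷ vertices s ++ vertices t ++ vertices d ++ x ∷ [ y ]) ++ D ++ zs
          ↭⟨ rearrange ([ hub ] ∷ vertices s ∷ vertices t ∷ vertices d ∷ [ x ] ∷ [ y ] ∷ D ∷ zs ∷ [])
               ((# 0 ⊕ # 1 ⊕ # 2 ⊕ # 3 ⊕ # 4 ⊕ # 5) ⊕ # 6 ⊕ # 7) (# 0 ⊕ # 1 ⊕ # 2 ⊕ (# 3 ⊕ # 6) ⊕ # 4 ⊕ # 5 ⊕ # 7) refl ⟩
        hub ∷ vertices s ++ vertices t ++ (vertices d ++ D) ++ x ∷ y ∷ zs ∎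

  singletons : ∀ {k P} xs → (∀ {b} → b ∈ xs → P b) →
               ∃[ ds ] concatMap (Segment.vertices {k} {P}) ds ≡ xs × length ds ≡ length xs
  singletons []       _   = [] , refl , refl
  singletons (x ∷ xs) all with singletons xs (λ b∈xs → all (there b∈xs))
  ... | ds , eq , n = segment [] (all (here refl)) (all (here refl)) ∷ ds , cong (x ∷_) eq , cong suc n

  -- Start from n + 2 outside vertices as one-vertex segments. The n merges and the last link
  -- through `u` spend n + 1 path vertices, hence (n + 2) + (n + 1) vertices in all.
  alternate-outside : ∀ n {k p L u v qs B} → Walk k u qs v → u ∷ qs ++ B ↭ L → suc (length qs) ≡ p → ¬ HasPath k (suc p) L →
                      2 + n ≤ length B → 2 * n ≤ length qs →
                      ∃[ r ] ∃[ zs ] ∃[ rest ]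
                        Segment.vertices {not k} {_∈ B} r ++ zs ++ rest ↭ L × length (Segment.vertices {not k} {_∈ B} r) ≡ 3 + 2 * n ×
                        length zs + 2 * n ≡ length qs × Linked (Covers (not k) (_∈ B)) zs
  alternate-outside n {k} {p} {L} {u} {v} {qs} {b₁ ∷ b₂ ∷ B} w σ size ¬P (s≤s (s≤s n≤B)) 2n≤qs
    with singletons {not k} {_∈ b₁ ∷ b₂ ∷ B} (take n B) (λ b∈ → there (there (take-⊆ b∈)))
    where
    take-⊆ : ∀ {b} → b ∈ take n B → b ∈ B
    take-⊆ b∈ = subst (_ ∈_) (take++drop≡id n B) (∈-++⁺ˡ b∈)
  ... | ds , ds-vertices , ds-size
    with connect (segment [] (here refl) (here refl)) (segment [] (there (here refl)) (there (here refl))) ds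
           (Maximal⇒start mx w) qs (linked-tail (Maximal⇒covers mx [] w)) (subst (λ m → 2 * m ≤ length qs) (sym ds≡n) 2n≤qs)
    where
    mx : Maximal k (u ∷ qs) (b₁ ∷ b₂ ∷ B)
    mx = longest⇒Maximal ¬P size σ
    ds≡n : length ds ≡ n
    ds≡n = trans ds-size (trans (length-take n B) (m≤n⇒m⊓n≡m n≤B))
  ... | r , zs , rest , τ , zs-size , cov , rest-size = r , zs , rest ++ drop n B , split , r-size ,
        subst (λ m → length zs + 2 * m ≡ length qs) ds≡n zs-size , cov
    where
    open Segment
    ds≡n : length ds ≡ n
    ds≡n = trans ds-size (trans (length-take n B) (m≤n⇒m⊓n≡m n≤B))
    D = concatMap vertices ds
    split : vertices r ++ zs ++ rest ++ drop n B ↭ L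
    split = begin
      vertices r ++ zs ++ rest ++ drop n B
        ↭⟨ rearrange (vertices r ∷ zs ∷ rest ∷ drop n B ∷ []) (# 0 ⊕ # 1 ⊕ # 2 ⊕ # 3) ((# 0 ⊕ # 1 ⊕ # 2) ⊕ # 3) refl ⟩
      (vertices r ++ zs ++ rest) ++ drop n B
        ↭⟨ ++⁺ʳ (drop n B) τ ⟩
      (u ∷ b₁ ∷ b₂ ∷ D ++ qs) ++ drop n B
        ≡⟨ cong (λ d → (u ∷ b₁ ∷ b₂ ∷ d ++ qs) ++ drop n B) ds-vertices ⟩
      (u ∷ b₁ ∷ b₂ ∷ take n B ++ qs) ++ drop n B
        ↭⟨ rearrange ([ u ] ∷ [ b₁ ] ∷ [ b₂ ] ∷ take n B ∷ qs ∷ drop n B ∷ []) ((# 0 ⊕ # 1 ⊕ # 2 ⊕ # 3 ⊕ # 4) ⊕ # 5) (# 0 ⊕ # 4 ⊕ # 1 ⊕ # 2 ⊕ # 3 ⊕ # 5) refl ⟩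
      u ∷ qs ++ b₁ ∷ b₂ ∷ take n B ++ drop n B
        ≡⟨ cong (λ l → u ∷ qs ++ b₁ ∷ b₂ ∷ l) (take++drop≡id n B) ⟩
      u ∷ qs ++ b₁ ∷ b₂ ∷ B
        ↭⟨ σ ⟩
      L ∎
      where open PermutationReasoning
    total : length (vertices r) + (length zs + length rest) ≡ 3 + (length D + length qs)
    total = begin
      length (vertices r) + (length zs + length rest)  ≡⟨ cong (length (vertices r) +_) (length-++ zs) ⟨
      length (vertices r) + length (zs ++ rest)        ≡⟨ length-++ (vertices r) ⟨
      length (vertices r ++ zs ++ rest)                ≡⟨ ↭-length τ ⟩
      3 + length (D ++ qs)                             ≡⟨ cong (3 +_) (length-++ D) ⟩
      3 + (length D + length qs)                       ∎
      where open ≡-Reasoning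
    -- The length is found by counting both sides of the permutation `τ`.
    r-size : length (vertices r) ≡ 3 + 2 * n
    r-size = segment-size (trans (cong length ds-vertices) (trans (sym ds-size) ds≡n)) (trans rest-size ds≡n)
               (subst (λ m → length zs + 2 * m ≡ length qs) ds≡n zs-size) total

  path-size : ∀ {p k L} (P : HasPath k p L) → p + length (HasPath.rest P) ≡ length L
  path-size (path {tail = qs} {rest} w refl σ) = trans (cong suc (sym (length-++ qs))) (↭-length σ)

  -- The negated form allows case distinctions on `HasPath` without deciding it.
  Unavoidable : ℕ → List V → Set
  Unavoidable p L = ¬ (∀ k → ¬ HasPath k p L)

  -- Mutual induction. From a path of colour `k` that is one vertex short and cannot be extended,
  -- `alternate-outside` gives a path of the other colour: long enough in the odd case, still one
  -- vertex short in the even case.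
  odd-path  : ∀ n {L} → 1 + 3 * n ≤ length L → Unavoidable (1 + 2 * n) L
  even-path : ∀ n {L} → 2 + 3 * n ≤ length L → Unavoidable (2 + 2 * n) L

  odd-path zero {x ∷ L} _ avoid = avoid true (path [] refl ↭-refl)
  odd-path (suc n) {L} le avoid = even-path n (≤-trans (m≤n+m (2 + 3 * n) 2) (≤-trans (≤-reflexive (triple-suc n)) le)) extend
    where
    extend : ∀ k → ¬ HasPath k (2 + 2 * n) L
    extend k P@(path {rest = B} w size σ)
      with alternate-outside n w σ size (subst (λ p → ¬ HasPath k p L) (sym (odd-suc n)) (avoid k)) (outside-even n le (path-size P))
             (≤-trans (n≤1+n _) (≤-reflexive (suc-injective (sym size))))
    ... | r , zs , rest , τ , r-size , _ = avoid (not k) (path (Segment.walk r) (trans r-size (odd-suc n)) τ)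

  even-path zero {_ ∷ []}    (s≤s ())
  even-path zero {x ∷ y ∷ L} _ avoid = avoid (c x y) (path (refl ∷ []) refl ↭-refl)
  even-path (suc n) {L} le avoid = odd-path (suc n) (≤-trans (n≤1+n _) le) extend
    where
    extend : ∀ k → ¬ HasPath k (1 + 2 * suc n) L
    extend k P@(path {rest = B} w size σ)
      with alternate-outside n w σ (trans size refl) (avoid k) (outside-odd n le (path-size P))
             (≤-trans (*-monoʳ-≤ 2 (n≤1+n n)) (≤-reflexive (suc-injective (sym size))))
    ... | r , [] , rest , τ , r-size , zs-size , _ = contradiction (trans zs-size (suc-injective size)) (<⇒≢ (*-monoʳ-< 2 (n<1+n n)))
    ... | r , y ∷ [] , rest , τ , r-size , zs-size , _ = contradiction (trans zs-size (suc-injective size)) (<⇒≢ (≤-reflexive (double-suc n)))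
    -- By `zs-size` two consecutive path vertices are left over. The head of `r` lies outside the
    -- path, so one of the two can be put in front of it.
    ... | r , y ∷ z ∷ zs , rest , τ , r-size , zs-size , cov ∷ _ with cov (Segment.head-P r)
    ...   | inj₁ e = avoid (not k) (path {rest = z ∷ zs ++ rest} (edge-sym e ∷ Segment.walk r) (trans (cong suc r-size) (cong suc (odd-suc n)))
              (↭-trans (rearrange ([ y ] ∷ Segment.vertices r ∷ [ z ] ∷ zs ∷ rest ∷ []) (# 0 ⊕ # 1 ⊕ # 2 ⊕ # 3 ⊕ # 4) (# 1 ⊕ (# 0 ⊕ # 2 ⊕ # 3) ⊕ # 4) refl) τ))
    ...   | inj₂ e = avoid (not k) (path {rest = y ∷ zs ++ rest} (edge-sym e ∷ Segment.walk r) (trans (cong suc r-size) (cong suc (odd-suc n)))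
              (↭-trans (rearrange ([ z ] ∷ Segment.vertices r ∷ [ y ] ∷ zs ∷ rest ∷ []) (# 0 ⊕ # 1 ⊕ # 2 ⊕ # 3 ⊕ # 4) (# 1 ⊕ (# 2 ⊕ # 0 ⊕ # 3) ⊕ # 4) refl) τ))

  -- A slightly weaker form of the theorem of Gerencsér and Gyárfás, R(P_p, P_p) = p + ⌊p/2⌋ - 1.
  monochromatic-path : ∀ p {L} → 1 ≤ p → p + ⌈ p /2⌉ ≤ suc (length L) → Unavoidable p L
  monochromatic-path p 1≤p le with parity p 1≤p
  ... | n , inj₁ refl = odd-path n (≤-pred (≤-trans (≤-reflexive (odd-bound n)) le))
  ... | n , inj₂ refl = even-path n (≤-pred (≤-trans (≤-reflexive (even-bound n)) le))

  -- Ends of longest paths.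

  -- If the first vertex u of a maximal walk is joined to a vertex y of the walk, then reversing the part
  -- before y shows that the predecessor of y is an end of a walk on the same vertices.
  endpoints : ∀ {k w u v ps qs O} → Walk k w ps u → Walk k w qs v → Maximal k (w ∷ ps ++ qs) O →
              ∃[ es ] ∃[ fs ] ∃[ bs ] ∃[ rs ]
                w ∷ qs ↭ es ++ fs × qs ↭ bs ++ rs × All (Edge (not k) u) bs × length es ≡ suc (length rs) ×
                (∀ {o e} → o ∈ O → e ∈ es → Edge (not k) o e)
  endpoints {w = w} p [] mx = [ w ] , [] , [] , [] , ↭-refl , ↭-refl , [] , refl ,
    λ { o∈O (here refl) → Maximal⇒start mx (p ++ʷ []) o∈O }
  endpoints {k} {w} {u} {v} {ps} {y ∷ qs} {O} p (e ∷ q) mx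
    with endpoints (edge-sym e ∷ p) q (Maximal-resp (rearrange ([ w ] ∷ ps ∷ [ y ] ∷ qs ∷ []) (# 0 ⊕ # 1 ⊕ # 2 ⊕ # 3) (# 2 ⊕ # 0 ⊕ # 1 ⊕ # 3) refl) mx)
       | colour-cases k u y
  ... | es , fs , bs , rs , σ , τ , blue , size , sep | inj₁ f =
    w ∷ es , fs , bs , y ∷ rs , prep w σ , ↭-trans (prep y τ) (↭-sym (shift y bs rs)) , blue , cong suc size , sep′
    where
    sep′ : ∀ {o e} → o ∈ O → e ∈ w ∷ es → Edge (not k) o e
    sep′ o∈O (there e∈es) = sep o∈O e∈es
    sep′ {o} o∈O (here refl) with colour-cases k o w
    ... | inj₂ g = g
    ... | inj₁ g = ⊥-elim (mx o∈O (g ∷ p ++ʷ (f ∷ q)) ↭-refl)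
  ... | es , fs , bs , rs , σ , τ , blue , size , sep | inj₂ f =
    es , w ∷ fs , y ∷ bs , rs , ↭-trans (prep w σ) (↭-sym (shift w es fs)) , prep y τ , f ∷ blue , size , sep

  -- A double-negated choice of j ≤ n with a path on j vertices and none on j + 1: otherwise the
  -- one-vertex path would grow step by step to n + 1 vertices.
  longest-path : ∀ n {k L} → ¬ HasPath k (suc n) L → HasPath k 1 L →
                 ¬ (∀ j → j ≤ n → HasPath k j L → ¬ ¬ HasPath k (suc j) L)
  longest-path zero    ¬P P₁ K = ¬P P₁
  longest-path (suc n) ¬P P₁ K =
    longest-path n (λ P → K (suc n) ≤-refl P ¬P) P₁ (λ j j≤n → K j (m≤n⇒m≤1+n j≤n))

  -- The first vertex of a longest path sends the other colour to `bs` and to all of `O`, together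
  -- fewer than `d` vertices. So `rs` is large, and with it `es`. The conclusion is in continuation
  -- form because a longest path is available only under double negation.
  separated-ends : ∀ n {k L d} → ¬ HasPath k (suc n) L → 1 ≤ length L →
                   (∀ {h bs rest} → h ∷ bs ++ rest ↭ L → All (Edge (not k) h) bs → length bs < d) →
                   ¬ (∀ {es fs O} → es ++ fs ++ O ↭ L → length es + length fs ≤ n → length L < length es + d →
                      ¬ (∀ {o e} → o ∈ O → e ∈ es → Edge (not k) o e))
  separated-ends n {k} {x ∷ L′} {d} ¬P _ few K = longest-path n ¬P (path [] refl ↭-refl) separate
    where
    L = x ∷ L′
    separate : ∀ j → j ≤ n → HasPath k j L → ¬ ¬ HasPath k (suc j) L
    separate j j≤n (path {u} {v} {qs} {O} w refl σ) ¬P′ with longest⇒Maximal ¬P′ refl σ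
    ... | mx with endpoints [] w mx
    ...   | es , fs , bs , rs , τ , τ′ , blue , size , sep = K split (≤-trans (≤-reflexive ends-size) j≤n) many sep
      where
      open PermutationReasoning
      split : es ++ fs ++ O ↭ L
      split = begin
        es ++ fs ++ O    ≡⟨ ++-assoc es fs O ⟨
        (es ++ fs) ++ O  ↭⟨ ++⁺ʳ O τ ⟨
        u ∷ qs ++ O      ↭⟨ σ ⟩
        L                ∎
      hub-split : u ∷ (bs ++ O) ++ rs ↭ L
      hub-split = begin
        u ∷ (bs ++ O) ++ rs  ↭⟨ rearrange ([ u ] ∷ bs ∷ O ∷ rs ∷ []) (# 0 ⊕ (# 1 ⊕ # 2) ⊕ # 3) (# 0 ⊕ (# 1 ⊕ # 3) ⊕ # 2) refl ⟩
        u ∷ (bs ++ rs) ++ O  ↭⟨ prep u (++⁺ʳ O τ′) ⟨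
        u ∷ qs ++ O          ↭⟨ σ ⟩
        L                    ∎
      ends-size : length es + length fs ≡ suc (length qs)
      ends-size = trans (sym (length-++ es)) (sym (↭-length τ))
      many : length L < length es + d
      many = ends-bound {length bs} {length rs}
        (subst (_< d) (length-++ bs) (few hub-split (All.++⁺ blue (All.tabulate (λ o∈O → edge-sym (Maximal⇒start mx w o∈O))))))
        (trans (↭-length τ′) (length-++ bs)) size (trans (cong suc (sym (length-++ qs))) (↭-length σ))

  -- Finding a monochromatic kipas.

  -- p counts the vertices of the path, so this is a kipas on p + 1 vertices.
  record HasKipas (k : Bool) (p : ℕ) (L : List V) : Set where
    constructor kipas
    field
      {hub start end} : V
      {tail rest}     : List V
      walk            : Walk k start tail end
      size            : suc (length tail) ≡ p
      spokes          : All (Edge k hub) (start ∷ tail)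
      split           : hub ∷ start ∷ tail ++ rest ↭ L

  HasKipas-mono : ∀ {k p M rest L} → M ++ rest ↭ L → HasKipas k p M → HasKipas k p L
  HasKipas-mono {rest = rest} σ (kipas {hub} {start} {end} {tail} {rest′} w n s τ) =
    kipas {rest = rest′ ++ rest} w n s
      (↭-trans (↭-reflexive (sym (++-assoc (hub ∷ start ∷ tail) rest′ rest))) (↭-trans (++⁺ʳ rest τ) σ))

  cone : ∀ {k p h M rest L} → h ∷ M ++ rest ↭ L → All (Edge k h) M → HasPath k p M → HasKipas k p L
  cone {h = h} {M} {rest} σ all (path {start} {end} {tail} {rest′} w n τ) =
    kipas {rest = rest′ ++ rest} w n (All.++⁻ˡ (start ∷ tail) (All-resp-↭ (↭-sym τ) all))
      (↭-trans (prep h (↭-trans (↭-reflexive (sym (++-assoc (start ∷ tail) rest′ rest))) (++⁺ʳ rest τ))) σ)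

  -- `X` and `Y` exchange roles at every step; since the first step enters `Y`, the larger half is
  -- needed there.
  alternating-walk : ∀ n {k} x X Y → (∀ {a b} → a ∈ x ∷ X → b ∈ Y → Edge k a b) → ⌈ n /2⌉ ≤ length Y → ⌊ n /2⌋ ≤ length X →
                     ∃[ qs ] ∃[ v ] ∃[ rest ] Walk k x qs v × length qs ≡ n × qs ++ rest ↭ X ++ Y
  alternating-walk zero    x X Y complete _ _ = [] , x , X ++ Y , [] , refl , ↭-refl
  alternating-walk (suc n) x X (y ∷ Y) complete (s≤s n≤Y) n≤X
    with alternating-walk n y Y X (λ a∈ b∈ → edge-sym (complete (there b∈) a∈)) n≤X n≤Y
  ... | qs , v , rest , w , size , σ = y ∷ qs , v , rest , complete (here refl) (here refl) ∷ w , cong suc size ,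
    ↭-trans (prep y σ) (rearrange ([ y ] ∷ Y ∷ X ∷ []) (# 0 ⊕ # 1 ⊕ # 2) (# 2 ⊕ # 0 ⊕ # 1) refl)

  alternating-kipas : ∀ n {k h X Y rest L} → h ∷ X ++ Y ++ rest ↭ L → (∀ {x} → x ∈ X → Edge k h x) → (∀ {y} → y ∈ Y → Edge k h y) →
                      (∀ {x y} → x ∈ X → y ∈ Y → Edge k x y) → ⌈ suc n /2⌉ ≤ length X → ⌊ suc n /2⌋ ≤ length Y →
                      HasKipas k (suc n) L
  alternating-kipas n {h = h} {x ∷ X} {Y} {rest} σ hX hY complete (s≤s X-size) Y-size
    with alternating-walk n x X Y complete Y-size X-size
  ... | qs , v , rest′ , w , size , τ =
    cone (↭-trans (prep h (↭-reflexive (++-assoc (x ∷ X) Y rest))) σ) (All.++⁺ (All.tabulate hX) (All.tabulate hY))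
      (path w (cong suc size) (prep x τ))

  pathless⇒kipas : ∀ n {k L} → 2 * suc n ≤ suc (length L) → ¬ HasPath k (suc n) L → ¬ ¬ HasKipas (not k) (suc n) L
  pathless⇒kipas n {k} {L} large ¬P ¬K =
    separated-ends n ¬P (≤-pred (≤-trans (m≤m+n 2 _) (≤-trans (*-monoʳ-≤ 2 (s≤s (z≤n {n}))) large))) few-blue separated
    where
    p = suc n
    halves : ⌊ p /2⌋ + ⌈ p /2⌉ ≡ p
    halves = ⌊n/2⌋+⌈n/2⌉≡n p

    sizes : ∀ (es fs : List V) {O M} → es ++ fs ++ O ↭ M → length es + (length fs + length O) ≡ length M
    sizes es fs σ = trans (sym (trans (length-++ es) (cong (length es +_) (length-++ fs)))) (↭-length σ)

    few-blue : ∀ {h bs rest} → h ∷ bs ++ rest ↭ L → All (Edge (not k) h) bs → length bs < n + ⌈ p /2⌉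
    -- Otherwise `bs` contains a monochromatic path on p vertices: in colour `k` it contradicts
    -- `¬P`, in the other colour `h` completes it to a kipas.
    few-blue {h} {bs} {rest} σ blue = ≰⇒> λ many → monochromatic-path p (s≤s z≤n) (s≤s many) avoid
      where
      avoid : ∀ j → ¬ HasPath j p bs
      avoid j P with j ≟ᵇ k
      ... | yes refl = ¬P (HasPath-mono {rest = h ∷ rest} (↭-trans (shift h bs rest) σ) P)
      ... | no j≢k   = ¬K (cone σ blue (subst (λ i → HasPath i p bs) (¬-not j≢k) P))

    separated : ∀ {es fs O} → es ++ fs ++ O ↭ L → length es + length fs ≤ n → length L < length es + (n + ⌈ p /2⌉) →
            ¬ (∀ {o e} → o ∈ O → e ∈ es → Edge (not k) o e)
    separated {es} {fs} {O} σ few many sep =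
      separated-ends n (λ P → ¬P (HasPath-mono (↭-trans O-first σ) P)) (≤-trans (s≤s z≤n) O-size) few-blue-outside separated-outside
      where
      O-first : O ++ es ++ fs ↭ es ++ fs ++ O
      O-first = rearrange (O ∷ es ∷ fs ∷ []) (# 0 ⊕ # 1 ⊕ # 2) (# 1 ⊕ # 2 ⊕ # 0) refl
      O-size : p ≤ length O
      O-size = outside-many {e = length es} large few (sizes es fs σ)
      es-size : ⌈ p /2⌉ ≤ length es
      -- `ends-many` gives more than ⌊p/2⌋ vertices, hence at least ⌈p/2⌉.
      es-size = ≤-trans (⌊n/2⌋-mono (n≤1+n (suc p))) (ends-many halves large many)

      few-blue-outside : ∀ {h bs rest} → h ∷ bs ++ rest ↭ O → All (Edge (not k) h) bs → length bs < ⌊ p /2⌋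
      few-blue-outside {h} {bs} {rest} τ blue = ≰⇒> λ bs-size →
        ¬K (alternating-kipas n {rest = fs ++ rest} split (sep h∈O) (All.lookup blue) (λ x∈ y∈ → edge-sym (sep (bs⊆O y∈) x∈)) es-size bs-size)
        where
        h∈O : h ∈ O
        h∈O = ∈-resp-↭ τ (here refl)
        bs⊆O : ∀ {b} → b ∈ bs → b ∈ O
        bs⊆O b∈ = ∈-resp-↭ τ (there (∈-++⁺ˡ b∈))
        open PermutationReasoning
        split : h ∷ es ++ bs ++ fs ++ rest ↭ L
        split = begin
          h ∷ es ++ bs ++ fs ++ rest  ↭⟨ rearrange ([ h ] ∷ es ∷ bs ∷ fs ∷ rest ∷ []) (# 0 ⊕ # 1 ⊕ # 2 ⊕ # 3 ⊕ # 4) (# 1 ⊕ # 3 ⊕ # 0 ⊕ # 2 ⊕ # 4) refl ⟩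
          es ++ fs ++ h ∷ bs ++ rest  ↭⟨ ++⁺ˡ es (++⁺ˡ fs τ) ⟩
          es ++ fs ++ O               ↭⟨ σ ⟩
          L                           ∎

      separated-outside : ∀ {es′ fs′ O′} → es′ ++ fs′ ++ O′ ↭ O → length es′ + length fs′ ≤ n → length O < length es′ + ⌊ p /2⌋ →
               ¬ (∀ {o e} → o ∈ O′ → e ∈ es′ → Edge (not k) o e)
      -- `O′` is not empty, as `es′` and `fs′` have at most n vertices together and `O` has at least
      -- n + 1.
      separated-outside {es′} {fs′} {[]} τ few′ _ _ = contradiction (outside-nonempty {e = length es′} O-size few′ (sizes es′ fs′ τ)) λ ()
      separated-outside {es′} {fs′} {h ∷ O″} τ few′ many′ sep′ =
        ¬K (alternating-kipas n {rest = fs ++ fs′ ++ O″} split (sep h∈O) (sep′ (here refl)) (λ x∈ y∈ → edge-sym (sep (es′⊆O y∈) x∈)) es-size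
              (≤-trans (⌊n/2⌋≤⌈n/2⌉ p) (<⇒≤ (ends-many′ halves O-size many′))))
        where
        h∈O : h ∈ O
        h∈O = ∈-resp-↭ τ (∈-++⁺ʳ es′ (∈-++⁺ʳ fs′ (here refl)))
        es′⊆O : ∀ {b} → b ∈ es′ → b ∈ O
        es′⊆O b∈ = ∈-resp-↭ τ (∈-++⁺ˡ b∈)
        open PermutationReasoning
        split : h ∷ es ++ es′ ++ fs ++ fs′ ++ O″ ↭ L
        split = begin
          h ∷ es ++ es′ ++ fs ++ fs′ ++ O″
            ↭⟨ rearrange ([ h ] ∷ es ∷ es′ ∷ fs ∷ fs′ ∷ O″ ∷ []) (# 0 ⊕ # 1 ⊕ # 2 ⊕ # 3 ⊕ # 4 ⊕ # 5) (# 1 ⊕ # 3 ⊕ # 2 ⊕ # 4 ⊕ # 0 ⊕ # 5) refl ⟩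
          es ++ fs ++ es′ ++ fs′ ++ h ∷ O″  ↭⟨ ++⁺ˡ es (++⁺ˡ fs τ) ⟩
          es ++ fs ++ O                     ↭⟨ σ ⟩
          L                                 ∎

  neighbourhoods : ∀ k h xs → ∃[ rs ] ∃[ bs ] rs ++ bs ↭ xs × All (Edge k h) rs × All (Edge (not k) h) bs
  neighbourhoods k h []       = [] , [] , ↭-refl , [] , []
  neighbourhoods k h (x ∷ xs) with neighbourhoods k h xs | colour-cases k h x
  ... | rs , bs , σ , rA , bA | inj₁ e = x ∷ rs , bs , prep x σ , e ∷ rA , bA
  ... | rs , bs , σ , rA , bA | inj₂ e = rs , x ∷ bs , ↭-trans (shift x rs bs) (prep x σ) , rA , e ∷ bA

  -- With p = n + 1, a vertex among 4p - 2 has at least 2p - 1 neighbours of one colour. A path of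
  -- that colour among them is completed by the vertex; without one, `pathless⇒kipas` applies.
  monochromatic-kipas : ∀ n {L} → 4 * suc n ≤ 2 + length L → ¬ (∀ k → ¬ HasKipas k (suc n) L)
  monochromatic-kipas n {[]}    le avoid = contradiction (≤-trans (*-monoʳ-≤ 4 (s≤s (z≤n {n}))) le) λ { (s≤s (s≤s ())) }
  monochromatic-kipas n {h ∷ L} le avoid with neighbourhoods true h L
  ... | rs , bs , σ , red , blue with majority {suc n} le (trans (sym (↭-length σ)) (length-++ rs))
  ...   | inj₁ large = pathless⇒kipas n {true} large (λ P → avoid true (cone (prep h σ) red P))
            (λ K → avoid false (HasKipas-mono {rest = h ∷ bs} (↭-trans (shift h rs bs) (prep h σ)) K))
  ...   | inj₂ large = pathless⇒kipas n {false} large (λ P → avoid false (cone (prep h τ) blue P))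
            (λ K → avoid true (HasKipas-mono {rest = h ∷ rs} (↭-trans (shift h bs rs) (prep h τ)) K))
    where
    τ : bs ++ rs ↭ L
    τ = ↭-trans (++-comm bs rs) σ

-- From vertex lists to copies of the kipas.

unique-prefix : ∀ {A : Set} (xs : List A) {ys} → Unique (xs ++ ys) → Unique xs
unique-prefix []       u       = []
unique-prefix (x ∷ xs) (p ∷ u) = All.++⁻ˡ xs p ∷ unique-prefix xs u

lookup-injective : ∀ {A : Set} {xs : List A} → Unique xs → ∀ {i j} → lookup xs i ≡ lookup xs j → i ≡ j
lookup-injective (p ∷ u) {zero}  {zero}  eq = refl
lookup-injective (p ∷ u) {zero}  {suc j} eq = contradiction eq (All.lookup p (∈-lookup j))
lookup-injective (p ∷ u) {suc i} {zero}  eq = contradiction (sym eq) (All.lookup p (∈-lookup i))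
lookup-injective (p ∷ u) {suc i} {suc j} eq = cong suc (lookup-injective u eq)

module _ {N : ℕ} (c : Colouring N) where

  open Colouring c using (col) renaming (sym to col-sym)
  open Walks col col-sym

  walk-edge : ∀ {k u xs v} → Walk k u xs v → (i j : Fin (suc (length xs))) → suc (toℕ i) ≡ toℕ j →
              col (lookup (u ∷ xs) i) (lookup (u ∷ xs) j) ≡ k
  walk-edge (e ∷ w) zero    (suc zero) _  = e
  walk-edge (e ∷ w) (suc i) (suc j)    eq = walk-edge w i j (suc-injective eq)
  walk-edge []      zero    zero       ()

  -- `allFin N` has no repetitions, hence neither has the list of hub and path, and `lookup` is
  -- injective on it.
  HasKipas⇒MonoCopy : ∀ {k p} → HasKipas k p (allFin N) → MonoCopy N c k (Kipas (suc p))
  HasKipas⇒MonoCopy {k} (kipas {hub} {start} {_} {tail} w refl spokes split) = lookup vs , lookup-injective vs-unique , edges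
    where
    vs = hub ∷ start ∷ tail
    vs-unique : Unique vs
    vs-unique = unique-prefix vs (Unique-resp-↭ (setoid (Fin N)) (↭⇒↭ₛ (↭-sym split)) (allFin⁺ N))
    edges : ∀ i j → KipasAdj i j → col (lookup vs i) (lookup vs j) ≡ k
    edges zero    (suc j) _         = All.lookup spokes (∈-lookup j)
    edges (suc i) zero    _         = edge-sym (All.lookup spokes (∈-lookup i))
    edges (suc i) (suc j) (inj₁ eq) = walk-edge w i j eq
    edges (suc i) (suc j) (inj₂ eq) = edge-sym (walk-edge w j i eq)

-- Decidability and existence of the Ramsey number.

KipasAdj? : ∀ {n} (i j : Fin n) → Dec (KipasAdj i j)
KipasAdj? zero    zero    = no λ ()
KipasAdj? zero    (suc j) = yes tt
KipasAdj? (suc i) zero    = yes tt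
KipasAdj? (suc i) (suc j) = (suc (toℕ i) ≟ toℕ j) ⊎-dec (suc (toℕ j) ≟ toℕ i)

-- Functions between finite types are enumerated up to pointwise equality through finToFun.
any-function? : ∀ {m n ℓ} {P : (Fin m → Fin n) → Set ℓ} → (∀ {f g} → f ≗ g → P f → P g) → (∀ f → Dec (P f)) → Dec (∃ P)
any-function? resp P? = map′ (λ (x , p) → finToFun x , p) (λ (f , p) → funToFin f , resp (λ i → sym (finToFun-funToFin f i)) p)
  (any? (λ x → P? (finToFun x)))

MonoCopy? : ∀ {n N} (c : Colouring N) k → Dec (MonoCopy N c k (Kipas n))
MonoCopy? c k = any-function? resp copy?
  where
  open Colouring c using (col)
  IsCopy : ∀ {n N} (c : Colouring N) → (Fin n → Fin N) → Set
  IsCopy c f = Injective _≡_ _≡_ f × (∀ i j → KipasAdj i j → Colouring.col c (f i) (f j) ≡ k)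
  resp : ∀ {f g} → f ≗ g → IsCopy c f → IsCopy c g
  resp f≗g (inj , edges) =
    (λ {i} {j} eq → inj (trans (f≗g i) (trans eq (sym (f≗g j))))) ,
    (λ i j a → trans (cong₂ col (sym (f≗g i)) (sym (f≗g j))) (edges i j a))
  copy? : ∀ f → Dec (IsCopy c f)
  copy? f = map′ (λ inj {i} {j} → inj i j) (λ inj i j → inj {i} {j})
      (all? λ i → all? λ j → (f i Fin.≟ f j) →-dec (i Fin.≟ j))
    ×-dec all? λ i → all? λ j → KipasAdj? i j →-dec (col (f i) (f j) ≟ᵇ k)

Monochromatic : ∀ n {N} → Colouring N → Set
Monochromatic n {N} c = MonoCopy N c red (Kipas n) ⊎ MonoCopy N c blue (Kipas n)

Monochromatic? : ∀ n {N} (c : Colouring N) → Dec (Monochromatic n c)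
Monochromatic? n c = MonoCopy? c red ⊎-dec MonoCopy? c blue

-- A colouring is coded by its matrix, a number below (2 ^ N) ^ N. `Good` presupposes symmetry, so
-- codes of asymmetric matrices pass vacuously.
Arrows? : ∀ n N → Dec (Arrows N (Kipas n) (Kipas n))
Arrows? n N = map′ from to (all? λ x → all-colourings? x)
  where
  open Inverse 2↔Bool using () renaming (to to bool; from to bit; strictlyInverseˡ to bool-bit)
  colours : Fin ((2 ^ N) ^ N) → Fin N → Fin N → Bool
  colours x i j = bool (finToFun (finToFun x i) j)
  code : (Fin N → Fin N → Bool) → Fin ((2 ^ N) ^ N)
  code f = funToFin (λ i → funToFin (λ j → bit (f i j)))
  colours-code : ∀ f i j → colours (code f) i j ≡ f i j
  colours-code f i j = trans
    (cong (λ y → bool (finToFun y j)) (finToFun-funToFin (λ i → funToFin (λ j → bit (f i j))) i))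
    (trans (cong bool (finToFun-funToFin (λ j → bit (f i j)) j)) (bool-bit (f i j)))
  Good : Fin ((2 ^ N) ^ N) → Set
  Good x = (s : ∀ i j → colours x i j ≡ colours x j i) → Monochromatic n (record { col = colours x ; sym = s })
  all-colourings? : ∀ x → Dec (Good x)
  all-colourings? x with all? (λ i → all? λ j → colours x i j ≟ᵇ colours x j i)
  ... | no ¬s = yes (λ s → contradiction s ¬s)
  ... | yes s = map′ (λ m _ → m) (λ g → g s) (Monochromatic? n (record { col = colours x ; sym = s }))
  to : Arrows N (Kipas n) (Kipas n) → ∀ x → Good x
  to arrows x s = arrows (record { col = colours x ; sym = s })
  from : (∀ x → Good x) → Arrows N (Kipas n) (Kipas n)
  from good c = Sum.map recolour recolour (good (code col) code-sym)
    where
    open Colouring c using (col) renaming (sym to col-sym)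
    same : ∀ i j → colours (code col) i j ≡ col i j
    same = colours-code col
    code-sym : ∀ i j → colours (code col) i j ≡ colours (code col) j i
    code-sym i j = trans (same i j) (trans (col-sym i j) (sym (same j i)))
    recolour : ∀ {k} → MonoCopy N (record { col = colours (code col) ; sym = code-sym }) k (Kipas n) → MonoCopy N c k (Kipas n)
    recolour (f , inj , edges) = f , inj , λ i j a → trans (sym (same (f i) (f j))) (edges i j a)

-- Containing a monochromatic kipas is decidable, so the double negation in `monochromatic-kipas`
-- can be removed.
Arrows-upper : ∀ p → Arrows (2 + 4 * p) (Kipas (2 + p)) (Kipas (2 + p))
Arrows-upper p c = decidable-stable (Monochromatic? _ c) λ ¬mono →
  Walks.monochromatic-kipas col col-sym p (≤-reflexive (trans (size p) (cong (2 +_) (sym (length-tabulate id)))))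
    λ { true K → ¬mono (inj₁ (HasKipas⇒MonoCopy c K)) ; false K → ¬mono (inj₂ (HasKipas⇒MonoCopy c K)) }
  where
  open Colouring c using (col) renaming (sym to col-sym)
  size : ∀ p → 4 * suc p ≡ 2 + (2 + 4 * p)
  size = solve-∀

-- Upward search from `k`, with `d` as fuel and `below` recording the failures so far.
least : ∀ {P : ℕ → Set} → (∀ N → Dec (P N)) → ∀ k d → (∀ N → 1 ≤ N → N < k → ¬ P N) → P (k + d) →
        ∃[ r ] k ≤ r × r ≤ k + d × P r × (∀ N → 1 ≤ N → N < r → ¬ P N)
least P? k d below Pkd with P? k
... | yes Pk = k , ≤-refl , m≤m+n k d , Pk , below
least {P} P? k zero below Pkd | no ¬Pk = contradiction (subst P (+-identityʳ k) Pkd) ¬Pk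
least {P} P? k (suc d) below Pkd | no ¬Pk with least P? (suc k) d below′ (subst P (+-suc k d) Pkd)
  where
  below′ : ∀ N → 1 ≤ N → N < suc k → ¬ P N
  below′ N 1≤N N<1+k with m<1+n⇒m<n∨m≡n N<1+k
  ... | inj₁ N<k  = below N 1≤N N<k
  ... | inj₂ refl = ¬Pk
... | r , k<r , r≤ , Pr , below-r = r , <⇒≤ k<r , ≤-trans r≤ (≤-reflexive (sym (+-suc k d))) , Pr , below-r

ramsey-number : ∀ p → ∃[ r ] IsRamseyNumber r (Kipas (2 + p)) (Kipas (2 + p)) × r ≤ 2 + 4 * p
ramsey-number p =
  let r , 1≤r , r≤ , arrows , below = least (Arrows? (2 + p)) 1 (1 + 4 * p) (λ N 1≤N N<1 → contradiction 1≤N (<⇒≱ N<1)) (Arrows-upper p)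
  in r , (1≤r , arrows , below) , r≤

-- Counting vertices by parts.

count : ∀ {A : Set} → (A → Bool) → List A → ℕ
count Q []       = 0
count Q (x ∷ xs) = if Q x then suc (count Q xs) else count Q xs

-- `first` and `skip` play `zero` and `suc` for ranks, whose range grows only when the head passes
-- the test.
first : ∀ {b n} → b ≡ true → Fin (if b then suc n else n)
first refl = zero

skip : ∀ b {n} → Fin n → Fin (if b then suc n else n)
skip true  i = suc i
skip false i = i

skip-injective : ∀ b {n} {i j : Fin n} → skip b i ≡ skip b j → i ≡ j
skip-injective true  refl = refl
skip-injective false refl = refl

first≢skip : ∀ {b n} (eq : b ≡ true) {i : Fin n} → ¬ first eq ≡ skip b i
first≢skip refl ()

module _ {A : Set} (Q : A → Bool) where

  -- Position among the entries that satisfy `Q`; being injective, it yields the pigeonhole bound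
  -- `injection⇒≤count`.
  rank : ∀ xs (i : Fin (length xs)) → Q (lookup xs i) ≡ true → Fin (count Q xs)
  rank (x ∷ xs) zero    eq = first eq
  rank (x ∷ xs) (suc i) eq = skip (Q x) (rank xs i eq)

  rank-injective : ∀ xs {i j} eq eq′ → rank xs i eq ≡ rank xs j eq′ → i ≡ j
  rank-injective (x ∷ xs) {zero}  {zero}  eq eq′ p = refl
  rank-injective (x ∷ xs) {zero}  {suc j} eq eq′ p = contradiction p (first≢skip eq)
  rank-injective (x ∷ xs) {suc i} {zero}  eq eq′ p = contradiction (sym p) (first≢skip eq′)
  rank-injective (x ∷ xs) {suc i} {suc j} eq eq′ p = cong suc (rank-injective xs eq eq′ (skip-injective (Q x) p))

  injection⇒≤count : ∀ {m} xs {f : Fin m → Fin (length xs)} → Injective _≡_ _≡_ f → (∀ i → Q (lookup xs (f i)) ≡ true) → m ≤ count Q xs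
  injection⇒≤count xs {f} inj all = injective⇒≤ {f = λ i → rank xs (f i) (all i)} λ eq → inj (rank-injective xs (all _) (all _) eq)

  count-++ : ∀ xs ys → count Q (xs ++ ys) ≡ count Q xs + count Q ys
  count-++ []       ys = refl
  count-++ (x ∷ xs) ys with Q x
  ... | true  = cong suc (count-++ xs ys)
  ... | false = count-++ xs ys

  count-replicate : ∀ n x → count Q (replicate n x) ≡ (if Q x then n else 0)
  count-replicate zero    x with Q x
  ... | true  = refl
  ... | false = refl
  count-replicate (suc n) x with Q x | count-replicate n x
  ... | true  | eq = cong suc eq
  ... | false | eq = eq

-- For part sizes `s`, the number of vertices in parts satisfying `Q`. On the closed list `parts` it
-- unfolds to an explicit sum.
weight : ∀ {A : Set} → (A → ℕ) → (A → Bool) → List A → ℕ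
weight s Q xs = sum (map (λ x → if Q x then s x else 0) xs)

blow-up : ∀ {A : Set} → (A → ℕ) → List A → List A
blow-up s = concatMap (λ x → replicate (s x) x)

count-blow-up : ∀ {A : Set} s (Q : A → Bool) xs → count Q (blow-up s xs) ≡ weight s Q xs
count-blow-up s Q []       = refl
count-blow-up s Q (x ∷ xs) = trans (count-++ Q (replicate (s x) x) (blow-up s xs)) (cong₂ _+_ (count-replicate Q (s x) x) (count-blow-up s Q xs))

length-blow-up : ∀ {A : Set} s (xs : List A) → length (blow-up s xs) ≡ sum (map s xs)
length-blow-up s []       = refl
length-blow-up s (x ∷ xs) = trans (length-++ (replicate (s x) x)) (cong₂ _+_ (length-replicate (s x)) (length-blow-up s xs))

chain-constant : ∀ {A : Set} {p} (h : Fin (suc p) → A) → (∀ i j → suc (toℕ i) ≡ toℕ j → h i ≡ h j) → ∀ i → h i ≡ h zero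
chain-constant         h step zero    = refl
chain-constant {p = suc p} h step (suc i) =
  trans (chain-constant (h ∘ suc) (λ i j eq → step (suc i) (suc j) (cong suc eq)) i) (sym (step zero (suc zero) refl))

pair-cons : ∀ {m p} → Fin 2 → (Fin m → Fin p) → Fin (suc m) → Fin (2 + p)
pair-cons {p = p} b h zero    = b ↑ˡ p
pair-cons         b h (suc i) = suc (suc (h i))

pair-cons-injective : ∀ {m p} b {h : Fin m → Fin p} → Injective _≡_ _≡_ h → Injective _≡_ _≡_ (pair-cons b h)
pair-cons-injective b          inj {zero}  {zero}  eq = refl
pair-cons-injective b          inj {suc i} {suc j} eq = cong suc (inj (Fin-suc-injective (Fin-suc-injective eq)))
pair-cons-injective zero       inj {zero}  {suc j} ()
pair-cons-injective (suc zero) inj {zero}  {suc j} ()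
pair-cons-injective zero       inj {suc i} {zero}  ()
pair-cons-injective (suc zero) inj {suc i} {zero}  ()

-- One element out of each of the disjoint pairs {0,1}, {2,3}, ….
half-selection : ∀ p {Q : Fin p → Set} → (∀ i j → suc (toℕ i) ≡ toℕ j → Q i ⊎ Q j) →
                 ∃[ h ] Injective _≡_ _≡_ h × ((i : Fin ⌊ p /2⌋) → Q (h i))
half-selection zero          cover = (λ ()) , (λ { {()} }) , λ ()
half-selection (suc zero)    cover = (λ ()) , (λ { {()} }) , λ ()
half-selection (suc (suc p)) cover with half-selection p (λ i j eq → cover (suc (suc i)) (suc (suc j)) (cong (2 +_) eq)) | cover zero (suc zero) refl
... | h , inj , all | inj₁ q = pair-cons zero h , pair-cons-injective zero inj , λ { zero → q ; (suc i) → all i }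
... | h , inj , all | inj₂ q = pair-cons (suc zero) h , pair-cons-injective (suc zero) inj , λ { zero → q ; (suc i) → all i }

-- The seven-part colouring.

Part : Set
Part = Fin 7

pattern κ = zero
pattern π = suc zero
pattern ω = suc (suc zero)
pattern α = suc (suc (suc zero))
pattern β = suc (suc (suc (suc zero)))
pattern γ = suc (suc (suc (suc (suc zero))))
pattern δ = suc (suc (suc (suc (suc (suc zero)))))

parts : List Part
parts = allFin 7

-- Blue is complete between κ and the rest; on the rest no blue edge joins π to {ω, α, β, γ, δ}.
-- With sizes 1, k, k, k, k the latter is 2k-regular on 4k + 1 vertices.
blue-pair : Part → Part → Bool
blue-pair κ κ = false
blue-pair κ _ = true
blue-pair π π = true
blue-pair ω ω = true
blue-pair ω α = true
blue-pair ω δ = true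
blue-pair α α = true
blue-pair α β = true
blue-pair β γ = true
blue-pair γ δ = true
blue-pair δ δ = true
blue-pair _ _ = false

isBlue isRed same : Part → Part → Bool
isBlue x y = blue-pair x y ∨ blue-pair y x
isRed x y  = not (isBlue x y)
same x y   = does (x Fin.≟ y)

outside-κ : Part → Bool
outside-κ κ = false
outside-κ _ = true

in-π : Part → Bool
in-π π = true
in-π _ = false

blue-outside-κ : ∀ x y → isBlue x y ≡ true → outside-κ x ≡ true ⊎ outside-κ y ≡ true
blue-outside-κ = from-yes (all? λ x → all? λ y → (isBlue x y ≟ᵇ true) →-dec ((outside-κ x ≟ᵇ true) ⊎-dec (outside-κ y ≟ᵇ true)))

blue-component : ∀ x y → outside-κ x ≡ true → outside-κ y ≡ true → isBlue x y ≡ true → in-π x ≡ in-π y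
blue-component = from-yes (all? λ x → all? λ y →
  (outside-κ x ≟ᵇ true) →-dec ((outside-κ y ≟ᵇ true) →-dec ((isBlue x y ≟ᵇ true) →-dec (in-π x ≟ᵇ in-π y))))

-- Bounds on closed neighbourhoods; the hub counts exactly when its own part is a clique of the colour in question.
record Balanced (p : ℕ) (s : Part → ℕ) : Set where
  field
    red-bound  : ∀ x → weight s (isRed x) parts < (if isRed x x then suc p else p)
    π-bound    : weight s in-π parts < p
    rest-bound : weight s (λ x → outside-κ x ∧ not (in-π x)) parts < p
    blue-bound : ∀ x → outside-κ x ≡ true → 1 ≤ weight s (same x) parts →
                 weight s (λ y → outside-κ y ∧ isBlue x y) parts < (if isBlue x x then suc ⌊ p /2⌋ else ⌊ p /2⌋)

∧-true : ∀ {x y} → x ≡ true → y ≡ true → x ∧ y ≡ true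
∧-true refl refl = refl

module _ {p : ℕ} {s : Part → ℕ} (balanced : Balanced (suc p) s) where

  open Balanced balanced

  size : ℕ
  size = length (blow-up s parts)

  part : Fin size → Part
  part = lookup (blow-up s parts)

  colouring : Colouring size
  colouring = record
    { col = λ i j → isRed (part i) (part j)
    ; sym = λ i j → cong not (∨-comm (blue-pair (part i) (part j)) (blue-pair (part j) (part i)))
    }

  ≤weight : ∀ {m} (Q : Part → Bool) {f : Fin m → Fin size} → Injective _≡_ _≡_ f → (∀ i → Q (part (f i)) ≡ true) → m ≤ weight s Q parts
  ≤weight Q inj all = ≤-trans (injection⇒≤count Q (blow-up s parts) inj all) (≤-reflexive (count-blow-up s Q parts))

  -- If the hub lies in a part that is red inside, the weight includes the hub, and all 2 + p
  -- vertices are counted; otherwise only the 1 + p path vertices are.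
  no-red-kipas : ¬ MonoCopy size colouring red (Kipas (2 + p))
  no-red-kipas (f , inj , edges) with isRed (part (f zero)) (part (f zero)) in self | red-bound (part (f zero))
  ... | true  | bound = <⇒≱ bound (≤weight (isRed (part (f zero))) inj λ { zero → self ; (suc j) → edges zero (suc j) tt })
  ... | false | bound = <⇒≱ bound (≤weight (isRed (part (f zero))) (Fin-suc-injective ∘ inj) λ j → edges zero (suc j) tt)

  no-blue-kipas : ¬ MonoCopy size colouring blue (Kipas (2 + p))
  no-blue-kipas (f , inj , edges) with outside-κ (part (f zero)) in hub
  -- Hub in `κ`: the path avoids `κ`, so it stays inside `π` or inside the rest, and each of these
  -- has at most p vertices.
  ... | false = in-component (in-π (v zero)) refl
    where
    v : Fin (suc p) → Part
    v i = part (f (suc i))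
    outside : ∀ i → outside-κ (v i) ≡ true
    outside i with blue-outside-κ (part (f zero)) (v i) (not-injective (edges zero (suc i) tt))
    ... | inj₁ eq = contradiction (trans (sym hub) eq) λ ()
    ... | inj₂ eq = eq
    component : ∀ i → in-π (v i) ≡ in-π (v zero)
    component = chain-constant (in-π ∘ v) λ i j eq →
      blue-component (v i) (v j) (outside i) (outside j) (not-injective (edges (suc i) (suc j) (inj₁ eq)))
    in-component : ∀ b → in-π (v zero) ≡ b → ⊥
    in-component true  eq = <⇒≱ π-bound (≤weight in-π (Fin-suc-injective ∘ inj) λ i → trans (component i) eq)
    in-component false eq = <⇒≱ rest-bound (≤weight (λ x → outside-κ x ∧ not (in-π x)) (Fin-suc-injective ∘ inj)
      λ i → ∧-true (outside i) (cong not (trans (component i) eq)))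
  -- Hub outside `κ`: no blue edge lies within `κ`, so one of any two consecutive path vertices is
  -- outside it. This gives ⌊(p + 1)/2⌋ blue neighbours outside `κ`.
  ... | true = too-many
    where
    t = part (f zero)
    v : Fin (suc p) → Part
    v i = part (f (suc i))
    present : 1 ≤ weight s (same t) parts
    present = ≤weight (same t) {λ (_ : Fin 1) → f zero} (λ { {zero} {zero} _ → refl }) (λ _ → dec-true (t Fin.≟ t) refl)
    near : Part → Bool
    near y = outside-κ y ∧ isBlue t y
    too-many : ⊥
    too-many with half-selection (suc p) {λ i → outside-κ (v i) ≡ true} (λ i j eq → blue-outside-κ (v i) (v j) (not-injective (edges (suc i) (suc j) (inj₁ eq))))
                | isBlue t t in self | blue-bound t hub present
    ... | h , h-inj , outside | false | bound = <⇒≱ bound (≤weight near (h-inj ∘ Fin-suc-injective ∘ inj)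
            λ i → ∧-true (outside i) (not-injective (edges zero (suc (h i)) tt)))
    ... | h , h-inj , outside | true  | bound = <⇒≱ bound (≤weight near {g} g-inj g-near)
      where
      -- The hub's own part is blue inside, so the hub is counted too.
      g : Fin (suc ⌊ suc p /2⌋) → Fin size
      g zero    = f zero
      g (suc i) = f (suc (h i))
      g-inj : Injective _≡_ _≡_ g
      g-inj {zero}  {zero}  _  = refl
      g-inj {zero}  {suc j} eq = contradiction (inj eq) λ ()
      g-inj {suc i} {zero}  eq = contradiction (inj eq) λ ()
      g-inj {suc i} {suc j} eq = cong suc (h-inj (Fin-suc-injective (inj eq)))
      g-near : ∀ i → near (part (g i)) ≡ true
      g-near zero    = ∧-true hub self
      g-near (suc i) = ∧-true (outside i) (not-injective (edges zero (suc (h i)) tt))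

  -- Otherwise the colouring restricts to `r` vertices, still without a monochromatic kipas.
  Arrows-lower : ∀ {r} → Arrows r (Kipas (2 + p)) (Kipas (2 + p)) → sum (map s parts) < r
  Arrows-lower {r} arrows = ≰⇒> λ r≤ → avoid (subst (r ≤_) (sym (length-blow-up s parts)) r≤)
    where
    avoid : ¬ (r ≤ size)
    avoid r≤ with arrows (record { col = λ i j → Colouring.col colouring (inject≤ i r≤) (inject≤ j r≤) ; sym = λ i j → Colouring.sym colouring (inject≤ i r≤) (inject≤ j r≤) })
    ... | inj₁ (f , inj , edges) = no-red-kipas ((λ i → inject≤ (f i) r≤) , inj ∘ inject≤-injective r≤ r≤ _ _ , edges)
    ... | inj₂ (f , inj , edges) = no-blue-kipas ((λ i → inject≤ (f i) r≤) , inj ∘ inject≤-injective r≤ r≤ _ _ , edges)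

-- Part sizes for the residues of n modulo 4.

sizes : (k p w a b c d : ℕ) → Part → ℕ
sizes k p w a b c d κ = k
sizes k p w a b c d π = p
sizes k p w a b c d ω = w
sizes k p w a b c d α = a
sizes k p w a b c d β = b
sizes k p w a b c d γ = c
sizes k p w a b c d δ = d

private
  halve-quadruple : ∀ k → ⌊ 4 * k /2⌋ ≡ 2 * k
  halve-quadruple k = trans (cong ⌊_/2⌋ (lemma k)) (⌊2n/2⌋≡n (2 * k))
    where
    lemma : ∀ k → 4 * k ≡ 2 * (2 * k)
    lemma = solve-∀

  two-pairs : ∀ k → (k + (k + 0)) + (k + (k + 0)) ≡ 4 * k
  two-pairs = solve-∀

  even-total : ∀ m {r} → sum (map (sizes (1 + 2 * m) m 0 m 0 0 m) parts) < r → 4 + 10 * m ≤ 2 * r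
  even-total m {r} lt = by-sum (*-monoʳ-≤ 2 lt) (lemma m r)
    where
    lemma : ∀ m r → 2 * r + 2 * suc ((1 + 2 * m) + (m + (m + (m + 0)))) ≡ (4 + 10 * m) + 2 * r
    lemma = solve-∀

  odd-total : ∀ m {r} → sum (map (sizes (2 + 2 * m) (1 + m) 0 m 0 0 m) parts) < r → 8 + 10 * m ≤ 2 * r
  odd-total m {r} lt = by-sum (*-monoʳ-≤ 2 lt) (lemma m r)
    where
    lemma : ∀ m r → 2 * r + 2 * suc ((2 + 2 * m) + ((1 + m) + (m + (m + 0)))) ≡ (8 + 10 * m) + 2 * r
    lemma = solve-∀

  regular-total : ∀ k {r} → sum (map (sizes (2 + 4 * k) (1 + 2 * k) 1 k k k k) parts) < r → 10 + 20 * k ≤ 2 * r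
  regular-total k {r} lt = by-sum (*-monoʳ-≤ 2 lt) (lemma k r)
    where
    lemma : ∀ k r → 2 * r + 2 * suc ((2 + 4 * k) + ((1 + 2 * k) + (1 + (k + (k + (k + (k + 0))))))) ≡ (10 + 20 * k) + 2 * r
    lemma = solve-∀

  quintuple-even : ∀ m → 5 * (2 + 2 * m) ≡ 6 + (4 + 10 * m)
  quintuple-even = solve-∀

  quintuple-odd : ∀ m → 5 * (3 + 2 * m) ≡ 6 + (9 + 10 * m)
  quintuple-odd = solve-∀

  quintuple-regular : ∀ k → 5 * (3 + 4 * k) ≡ 6 + (9 + 20 * k)
  quintuple-regular = solve-∀

-- For n = 2m + 2: outside `κ`, blue consists of three cliques on m vertices each.
balanced-even : ∀ m → Balanced (1 + 2 * m) (sizes (1 + 2 * m) m 0 m 0 0 m)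
balanced-even m = record
  { red-bound  = λ
    { κ → ≤-reflexive (cong (2 +_) (+-identityʳ (2 * m)))
    ; π → ≤-refl
    ; ω → s≤s (+-monoʳ-≤ m z≤n)
    ; α → ≤-refl
    ; β → n≤1+n _
    ; γ → n≤1+n _
    ; δ → ≤-refl
    }
  ; π-bound    = s≤s (+-monoʳ-≤ m z≤n)
  ; rest-bound = ≤-refl
  ; blue-bound = λ
    { π _ _ → s≤s (≤-reflexive half)
    -- `ω`, `β` and `γ` are empty, against the premise that the part has a vertex.
    ; ω _ ()
    ; α _ _ → s≤s (≤-reflexive half)
    ; β _ ()
    ; γ _ ()
    ; δ _ _ → s≤s (≤-reflexive half)
    }
  }
  where
  half : m + 0 ≡ ⌈ 2 * m /2⌉
  half = trans (+-identityʳ m) (sym (⌈2n/2⌉≡n m))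

-- For n = 2m + 3: outside `κ`, blue cliques on m + 1, m and m vertices. Only `π` attains the degree
-- m = (n - 3)/2.
balanced-odd : ∀ m → Balanced (2 + 2 * m) (sizes (2 + 2 * m) (1 + m) 0 m 0 0 m)
balanced-odd m = record
  { red-bound  = λ
    { κ → ≤-reflexive (cong (3 +_) (+-identityʳ (2 * m)))
    ; π → n≤1+n _
    ; ω → s≤s (s≤s (+-monoʳ-≤ m z≤n))
    ; α → ≤-refl
    ; β → n≤1+n _
    ; γ → n≤1+n _
    ; δ → ≤-refl
    }
  ; π-bound    = s≤s (s≤s (+-monoʳ-≤ m z≤n))
  ; rest-bound = n≤1+n _
  ; blue-bound = λ
    { π _ _ → s≤s (s≤s (≤-reflexive half))
    ; ω _ ()
    ; α _ _ → s≤s (m≤n⇒m≤1+n (≤-reflexive half))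
    ; β _ ()
    ; γ _ ()
    ; δ _ _ → s≤s (m≤n⇒m≤1+n (≤-reflexive half))
    }
  }
  where
  half : m + 0 ≡ ⌊ 2 * m /2⌋
  half = trans (+-identityʳ m) (sym (⌊2n/2⌋≡n m))

-- For n = 4k + 3: outside `κ`, a blue clique on 2k + 1 vertices and a 2k-regular blue graph on 4k +
-- 1. All blue degrees there equal (n - 3)/2, which gains one vertex over `balanced-odd`.
balanced-regular : ∀ k → Balanced (2 + 4 * k) (sizes (2 + 4 * k) (1 + 2 * k) 1 k k k k)
balanced-regular k = record
  { red-bound  = λ
    { κ → ≤-reflexive (cong (3 +_) (+-identityʳ (4 * k)))
    ; π → ≤-refl
    ; ω → s≤s (s≤s (≤-reflexive (two-pairs k)))
    ; α → s≤s (s≤s (≤-reflexive (two-pairs k)))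
    ; β → s≤s (s≤s self-included)
    ; γ → s≤s (s≤s self-included)
    ; δ → s≤s (s≤s (≤-reflexive (two-pairs k)))
    }
  ; π-bound    = s≤s (s≤s (≤-trans (+-monoʳ-≤ (2 * k) z≤n) (≤-reflexive (two-pairs k))))
  ; rest-bound = ≤-refl
  ; blue-bound = λ
    { π _ _ → s≤s (s≤s (≤-reflexive (trans (+-identityʳ (2 * k)) half)))
    ; ω _ _ → s≤s (s≤s (≤-reflexive half))
    ; α _ _ → s≤s (s≤s (≤-reflexive half))
    ; β _ _ → s≤s (≤-reflexive half)
    ; γ _ _ → s≤s (≤-reflexive half)
    ; δ _ _ → s≤s (s≤s (≤-reflexive half))
    }
  }
  where
  half : 2 * k ≡ ⌊ 4 * k /2⌋
  half = sym (halve-quadruple k)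
  self-included : 2 * k + suc (2 * k) ≤ suc (4 * k)
  self-included = ≤-reflexive (trans (+-suc (2 * k) (2 * k)) (cong suc (two-pairs k)))

-- Assembling both bounds over the integers.

-- Opened only here: the prefix +_ would make sections such as (2 +_) ambiguous.
open import Data.Integer using (+_; _-_; -_; 0ℤ; 1ℤ; +≤+) renaming (_+_ to _+ℤ_; _≤_ to _≤ℤ_)

LowerBound : ℕ → ℕ → Set
LowerBound n r = (+ (5 * n) - + 6) +ℤ sgn′ n ≤ℤ + (2 * r)

-- Once 5n is written as 6 + a, the integer subtraction of 6 computes.
LowerBound-intro : ∀ n {r a s} → 5 * n ≡ 6 + a → sgn′ n ≡ s → + a +ℤ s ≤ℤ + (2 * r) → LowerBound n r
LowerBound-intro n {r} {a} eq sgn le =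
  subst (λ z → (+ z - + 6) +ℤ sgn′ n ≤ℤ + (2 * r)) (sym eq) (subst (λ s → + a +ℤ s ≤ℤ + (2 * r)) (sym sgn) le)

module _ {n r : ℕ} (arrows : Arrows r (Kipas n) (Kipas n)) where

  lower-even : ∀ m → n ≡ 2 + 2 * m → sgn′ n ≡ 0ℤ → LowerBound n r
  lower-even m refl sgn = LowerBound-intro n {r} (quintuple-even m) sgn
    (+≤+ (≤-trans (≤-reflexive (+-identityʳ _)) (even-total m (Arrows-lower (balanced-even m) arrows))))

  lower-odd : ∀ m → n ≡ 3 + 2 * m → sgn′ n ≡ - 1ℤ → LowerBound n r
  lower-odd m refl sgn = LowerBound-intro n {r} (quintuple-odd m) sgn
    (+≤+ (odd-total m (Arrows-lower (balanced-odd m) arrows)))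

  lower-regular : ∀ k → n ≡ 3 + 4 * k → sgn′ n ≡ 1ℤ → LowerBound n r
  lower-regular k refl sgn = LowerBound-intro n {r} (quintuple-regular k) sgn
    (+≤+ (≤-trans (≤-reflexive (+-comm _ 1)) (regular-total k (Arrows-lower (balanced-regular k) arrows))))

sgn′-0 : ∀ n → n % 4 ≡ 0 → sgn′ n ≡ 0ℤ
sgn′-0 n eq with n % 4 | eq
... | _ | refl = refl

sgn′-1 : ∀ n → n % 4 ≡ 1 → sgn′ n ≡ - 1ℤ
sgn′-1 n eq with n % 4 | eq
... | _ | refl = refl

sgn′-2 : ∀ n → n % 4 ≡ 2 → sgn′ n ≡ 0ℤ
sgn′-2 n eq with n % 4 | eq
... | _ | refl = refl

sgn′-3 : ∀ n → n % 4 ≡ 3 → sgn′ n ≡ 1ℤ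
sgn′-3 n eq with n % 4 | eq
... | _ | refl = refl

-- Residues 0 and 2 use three equal cliques, residue 1 the unequal ones, residue 3 the regular
-- graph.
lower-bound : ∀ n {r} → 5 ≤ n → Arrows r (Kipas n) (Kipas n) → LowerBound n r
lower-bound n {r} 5≤n arrows = by-residue (n % 4) (n / 4) refl (m≡m%n+[m/n]*n n 4) (m%n<n n 4)
  where
  by-residue : ∀ i q → n % 4 ≡ i → n ≡ i + q * 4 → i < 4 → LowerBound n r
  by-residue 0 zero    _  eq _ = contradiction (subst (5 ≤_) eq 5≤n) λ ()
  by-residue 0 (suc q) %4 eq _ = lower-even arrows (1 + 2 * q) (trans eq (lemma q)) (sgn′-0 n %4)
    where
    lemma : ∀ q → suc q * 4 ≡ 2 + 2 * (1 + 2 * q)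
    lemma = solve-∀
  by-residue 1 zero    _  eq _ = contradiction (subst (5 ≤_) eq 5≤n) λ { (s≤s ()) }
  by-residue 1 (suc q) %4 eq _ = lower-odd arrows (1 + 2 * q) (trans eq (lemma q)) (sgn′-1 n %4)
    where
    lemma : ∀ q → 1 + suc q * 4 ≡ 3 + 2 * (1 + 2 * q)
    lemma = solve-∀
  by-residue 2 q       %4 eq _ = lower-even arrows (2 * q) (trans eq (lemma q)) (sgn′-2 n %4)
    where
    lemma : ∀ q → 2 + q * 4 ≡ 2 + 2 * (2 * q)
    lemma = solve-∀
  by-residue 3 q       %4 eq _ = lower-regular arrows q (trans eq (cong (λ i → 3 + i) (*-comm q 4))) (sgn′-3 n %4)
  by-residue (suc (suc (suc (suc _)))) _ _ _ (s≤s (s≤s (s≤s (s≤s ()))))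

theorem5 : (n : ℕ) → 5 ≤ n →
    Σ ℕ λ r → IsRamseyNumber r (Kipas n) (Kipas n) ×
    ((+ (5 * n) - + 6) +ℤ sgn′ n ≤ℤ + (2 * r)) × (r ≤ 4 * n ∸ 6)
theorem5 (suc zero)    (s≤s ())
theorem5 (suc (suc p)) 5≤n =
  let r , ramsey , r≤ = ramsey-number p
  in r , ramsey , lower-bound (2 + p) 5≤n (proj₁ (proj₂ ramsey)) , ≤-trans r≤ (≤-reflexive (cong (_∸ 6) (lemma p)))
  where
  lemma : ∀ p → 6 + (2 + 4 * p) ≡ 4 * (2 + p)
  lemma = solve-∀
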